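{- For every pair of integers $t,k\in\mathbb{N}$ there exists $N\in\mathbb{N}$ such that every bipartite graph that excludes $P_t$, $\widetilde{P_t}$, and $H_k$ as induced subgraphs admits a $2$-cosplit of size at most $N$ and height at most $4k$.
   Context: Bipartite graphs come with a fixed bipartition into two sides; induced subgraphs inherit the bipartition, and "excludes $H$ as an induced subgraph" means no induced subgraph is isomorphic to $H$ as a bipartite graph. $P_t$ is the path on $t$ vertices, $\widetilde{P_t}$ its bipartite complement (adjacency between the two sides complemented). $H_k$ has sides $\{a_1,\dots,a_k\}$, $\{b_1,\dots,b_k\}$ and edges $a_ib_j$ for $1\le i\le j\le k$. For disjoint $A,B$, $G[A,B]$ is the bipartite graph with sides $A,B$ and the edges of $G$ between them. A cograph of height at most $h$ is a graph defined by a cotree: a rooted tree $T$ of height at most $h$ (max edges on a root-to-leaf path) whose leaves are the vertices, with $f:I(T)\to\{0,1\}$ on internal vertices, distinct leaves $u,v$ adjacent iff $f(u\wedge v)=1$ ($u\wedge v$ = lowest common ancestor). A bi-cograph of height at most $h$ is a bipartite graph defined by a bi-cotree: a rooted tree $T$ of height at most $h$ whose leaves are the vertices, $c$ the side-coloring of leaves into $\{1,2\}$, and $f:I(T)\times[2]\times[2]\to\{0,1\}$ symmetric in the last two arguments with $f(x,1,1)=f(x,2,2)=0$, where $u,v$ are adjacent iff $f(u\wedge v,c(u),c(v))=1$. For a bipartite graph $G$, a $2$-cosplit is a partition $\mathscr{P}$ of $V(G)$ such that every part is contained in one side of $G$, $G[A]$ is a cograph for every $A\in\mathscr{P}$, and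 $G[A,B]$ is a bi-cograph for all distinct $A,B\in\mathscr{P}$. Its size is $|\mathscr{P}|$; it has height at most $h$ if all these cographs and bi-cographs have height at most $h$. -}

module Defs where

open import Data.Nat using (ℕ; zero; suc; _≤_; _*_; ⌊_/2⌋; ⌈_/2⌉; _≡ᵇ_; _≤ᵇ_)
open import Data.Fin using (Fin; zero; suc; toℕ)
open import Data.Bool using (Bool; true; false; not; _∨_)
open import Data.Sum using (_⊎_; inj₁; inj₂)
open import Data.Product using (Σ; _×_; ∃-syntax; _,_)
open import Relation.Binary.PropositionalEquality using (_≡_; _≢_)
open import Relation.Nullary using (¬_)
open import Function.Definitions using (Injective)

record BGraph : Set where
  field
    m   : ℕ
    n   : ℕ
    adj : Fin m → Fin n → Bool
open BGraph public

Vertex : BGraph → Set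
Vertex G = Fin (m G) ⊎ Fin (n G)

Adj : (G : BGraph) → Vertex G → Vertex G → Bool
Adj G (inj₁ a) (inj₂ b) = adj G a b
Adj G (inj₂ b) (inj₁ a) = adj G a b
Adj G (inj₁ _) (inj₁ _) = false
Adj G (inj₂ _) (inj₂ _) = false

sideOf : (G : BGraph) → Vertex G → Bool
sideOf G (inj₁ _) = true
sideOf G (inj₂ _) = false

-- Induced subgraphs, up to isomorphism of bipartite graphs.
-- An isomorphism of bipartite graphs maps sides to sides; we allow the
-- two sides to be exchanged.

record SameSideEmb (H G : BGraph) : Set where
  field
    f₁    : Fin (m H) → Fin (m G)
    f₂    : Fin (n H) → Fin (n G)
    inj₁' : Injective _≡_ _≡_ f₁
    inj₂' : Injective _≡_ _≡_ f₂
    pres  : ∀ a b → adj H a b ≡ adj G (f₁ a) (f₂ b)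

record SwapSideEmb (H G : BGraph) : Set where
  field
    f₁    : Fin (m H) → Fin (n G)
    f₂    : Fin (n H) → Fin (m G)
    inj₁' : Injective _≡_ _≡_ f₁
    inj₂' : Injective _≡_ _≡_ f₂
    pres  : ∀ a b → adj H a b ≡ adj G (f₂ b) (f₁ a)

InducedIn : BGraph → BGraph → Set
InducedIn H G = SameSideEmb H G ⊎ SwapSideEmb H G

Excludes : BGraph → BGraph → Set
Excludes G H = ¬ InducedIn H G

-- path P_t on vertices 0..t-1; side 1 = even vertices (2i), side 2 = odd
-- vertices (2j+1); 2i ~ 2j+1 iff i = j or i = j+1
P : ℕ → BGraph
P t = record
  { m = ⌈ t /2⌉
  ; n = ⌊ t /2⌋
  ; adj = λ i j → (toℕ i ≡ᵇ toℕ j) ∨ (toℕ i ≡ᵇ suc (toℕ j))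
  }

bcomp : BGraph → BGraph
bcomp G = record { m = m G ; n = n G ; adj = λ a b → not (adj G a b) }

H : ℕ → BGraph
H k = record { m = k ; n = k ; adj = λ i j → toℕ i ≤ᵇ toℕ j }

data Tree (L V : Set) : Set where
  leaf : V → Tree L V
  node : L → (k : ℕ) → (Fin (suc k) → Tree L V) → Tree L V

-- v is (labels) a leaf of T; distinct proofs = distinct leaf occurrences
data _∈T_ {L V : Set} (v : V) : Tree L V → Set where
  here  : v ∈T leaf v
  child : ∀ {x k c} (i : Fin (suc k)) → v ∈T c i → v ∈T node x k c

data Height≤ {L V : Set} : ℕ → Tree L V → Set where
  leaf : ∀ {h v} → Height≤ h (leaf v)
  node : ∀ {h x k c} → (∀ i → Height≤ h (c i)) → Height≤ (suc h) (node x k c)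

data Lca {L V : Set} : Tree L V → V → V → L → Set where
  split : ∀ {x k c u v} (i j : Fin (suc k)) → i ≢ j →
          u ∈T c i → v ∈T c j → Lca (node x k c) u v x
  down  : ∀ {x k c u v y} (i : Fin (suc k)) →
          Lca (c i) u v y → Lca (node x k c) u v y

data AllLabels {L V : Set} (P : L → Set) : Tree L V → Set where
  leaf : ∀ {v} → AllLabels P (leaf v)
  node : ∀ {x k c} → P x → (∀ i → AllLabels P (c i)) → AllLabels P (node x k c)

LeavesExactly : {L V : Set} → Tree L V → (V → Set) → Set
LeavesExactly {V = V} T S =
  (∀ (v : V) → v ∈T T → S v) ×
  (∀ (v : V) → S v → v ∈T T) ×
  (∀ (v : V) (p q : v ∈T T) → p ≡ q)

IsCograph : {V : Set} → ℕ → (S : V → Set) → (V → V → Bool) → Set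
IsCograph {V} h S adj' =
  Σ (Tree Bool V) λ T →
    Height≤ h T × LeavesExactly T S ×
    (∀ (u v : V) (x : Bool) → u ≢ v → u ∈T T → v ∈T T →
       Lca T u v x → adj' u v ≡ x)

BiLabel : Set
BiLabel = Fin 2 → Fin 2 → Bool

ValidBiLabel : BiLabel → Set
ValidBiLabel f =
  (∀ a b → f a b ≡ f b a) × (f zero zero ≡ false) × (f (suc zero) (suc zero) ≡ false)

Col : {V : Set} → (V → Set) → (V → Set) → V → Fin 2 → Set
Col A B v zero    = A v
Col A B v (suc _) = B v

-- adjacency of G[A,B]: only edges between different colours
cross : Fin 2 → Fin 2 → Bool → Bool
cross zero    zero    _ = false
cross zero    (suc _) b = b
cross (suc _) zero    b = b
cross (suc _) (suc _) _ = false

IsBiCograph : {V : Set} → ℕ → (A B : V → Set) → (V → V → Bool) → Set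
IsBiCograph {V} h A B adj' =
  Σ (Tree BiLabel V) λ T →
    Height≤ h T × AllLabels ValidBiLabel T ×
    LeavesExactly T (λ v → A v ⊎ B v) ×
    (∀ (u v : V) (f : BiLabel) (cu cv : Fin 2) → u ≢ v → u ∈T T → v ∈T T →
       Lca T u v f → Col A B u cu → Col A B v cv →
       cross cu cv (adj' u v) ≡ f cu cv)

-- 2-cosplits of size ≤ N and height ≤ h.
-- A partition into s (nonempty) parts is given by a surjection
-- part : V(G) → Fin s.

Cosplit : BGraph → ℕ → ℕ → Set
Cosplit G N h =
  Σ ℕ λ s → s ≤ N ×
  Σ (Vertex G → Fin s) λ part →
    (∀ i → ∃[ v ] part v ≡ i) ×
    (∀ i → ∃[ side ] (∀ v → part v ≡ i → sideOf G v ≡ side)) ×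
    (∀ i → IsCograph h (λ v → part v ≡ i) (Adj G)) ×
    (∀ i j → i ≢ j → IsBiCograph h (λ v → part v ≡ i) (λ v → part v ≡ j) (Adj G))

-- Call edges and non-edges between the two sides the colours true and false.
--
-- One step, in colour c: decompose into components of colour not c (one level of the bi-cotree,
-- labelled c) and follow an induced path of colour c as Gyárfás does. With v the end of the path
-- and C a component attached to it, the vertices of C on the side of v or c-adjacent to v form a
-- set to which v is uniform, while the rest of C falls into components of colour c, to which the
-- path is extended. Excluding P_t and its complement bounds the number of rounds, and each
-- round only multiplies the number of parts. All the components of colour c arising in different
-- rounds are separated by the colour not c, so they share a single level of the bi-cotree, which
-- is also the first level of the next step, in colour not c.
--
-- A uniform vertex v, together with a vertex a joined to it in the other colour and made uniform
-- by one further split, lengthens one of two half-graphs built from the outside in, one for each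
-- choice of the dominating side. Without H_k each has length at most 2k - 2 above a set
-- containing both an edge and a non-edge, so the number of steps depends on k only.
module Submission where

open import Defs
open import Data.Nat using (ℕ; zero; suc; _+_; _*_; _∸_; _≤_; _<_; z≤n; s≤s; _≤ᵇ_; _≡ᵇ_; ⌊_/2⌋; ⌈_/2⌉)
open import Data.Nat.Properties using
  ( ≤-refl; ≤-trans; ≤-reflexive; ≤-pred; ≤-antisym; ≰⇒>; _≤?_; <-cmp; <⇒≤; n≮n; n≤1+n
  ; ≤ᵇ⇒≤; ≤⇒≤ᵇ; +-suc; +-comm; +-identityʳ; +-mono-≤; *-suc; suc-injective; m+[n∸m]≡n)
open import Data.Bool using (Bool; true; false; not; _∨_; _xor_; if_then_else_)
open import Data.Bool.Properties using (¬-not; not-¬; not-involutive; T-≡) renaming (_≟_ to _≟ᵇ_)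
open import Data.Empty using (⊥; ⊥-elim)
open import Data.Fin using (Fin; zero; suc; toℕ; combine)
import Data.Fin.Properties as Fin
open import Data.List using (List; []; _∷_; _++_; map; allFin; cartesianProduct)
open import Data.List.Membership.Propositional using (_∈_; find; lose)
open import Data.List.Membership.Propositional.Properties using (∈-cartesianProduct⁺; ∈-++⁺ˡ; ∈-++⁺ʳ; ∈-map⁺; ∈-allFin)
open import Data.List.Properties using (≡-dec; ∷-injectiveˡ; ∷-injectiveʳ)
open import Data.List.Relation.Unary.Any using (here; there; any?)
open import Data.Product using (Σ; ∃; ∃-syntax; _×_; _,_; proj₁; proj₂)
open import Data.Sum using (_⊎_; inj₁; inj₂)
import Data.Sum as Sum
import Data.Sum.Properties as Sum
open import Data.Unit using (⊤; tt)
open import Function using (_∘_)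
open import Function.Bundles using (Equivalence)
open import Relation.Binary.Definitions using (DecidableEquality; tri<; tri≈; tri>)
open import Relation.Binary.PropositionalEquality using (_≡_; _≢_; refl; sym; trans; cong; cong₂; subst; subst₂)
open import Relation.Nullary using (¬_; Dec; yes; no; does; contradiction)
open import Relation.Nullary.Decidable using (_×-dec_; _⊎-dec_; ¬?; dec-true; dec-false)
open import Relation.Unary using (Decidable)

-- Label types and the arithmetic of colours.

data Labels : Set where
  unit : Labels
  mux  : Labels → Labels → Labels

-- A universe of finite types: the labels of a split are fixed by `t` and the number of steps alone,
-- so their number can bound the parts for all graphs at once.
⟦_⟧ : Labels → Set
⟦ unit ⟧    = ⊤
⟦ mux a b ⟧ = ⟦ a ⟧ × ⟦ b ⟧ × Bool

someLabel : ∀ L → ⟦ L ⟧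
someLabel unit      = tt
someLabel (mux a b) = someLabel a , someLabel b , true

-- Each round of the path search splits off a set uniform to the end of the path, itself split once
-- more, whence `mux L L`; the rest goes to the remaining `f` rounds.
searchLabels : ℕ → Labels → Labels
searchLabels zero    L = unit
searchLabels (suc f) L = mux (mux L L) (searchLabels f L)

splitLabels : (t r : ℕ) → Labels
splitLabels t zero    = unit
splitLabels t (suc r) = searchLabels t (splitLabels t r)

double : ℕ → ℕ
double zero    = zero
double (suc n) = suc (suc (double n))

near : ℕ → ℕ → Bool
near (suc x) (suc y) = near x y
near zero    y       = y ≡ᵇ 1
near x       zero    = x ≡ᵇ 1

xor-opp : ∀ {a b} c → a ≢ b → a xor not c ≡ b xor c
xor-opp {true}  {true}  c     a≢b = contradiction refl a≢b
xor-opp {false} {false} c     a≢b = contradiction refl a≢b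
xor-opp {true}  {false} true  _   = refl
xor-opp {true}  {false} false _   = refl
xor-opp {false} {true}  true  _   = refl
xor-opp {false} {true}  false _   = refl

xor-differ : ∀ {a b} c → a ≢ b → a xor c ≢ b xor c
xor-differ {a} {b} c a≢b eq = not-¬ {b xor c} refl (trans (sym eq) flipped)
  where
  flipped : a xor c ≡ not (b xor c)
  flipped = trans (cong (_xor c) (¬-not a≢b)) (not-xor b)
    where
    not-xor : ∀ b → not b xor c ≡ not (b xor c)
    not-xor true  = sym (not-involutive c)
    not-xor false = refl

≢-≢⇒≡ : {a b c : Bool} → a ≢ c → b ≢ c → a ≡ b
≢-≢⇒≡ a≢c b≢c = trans (¬-not a≢c) (sym (¬-not b≢c))

does-true : ∀ {A : Set} (a? : Dec A) → does a? ≡ true → A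
does-true (yes a) _ = a

does-false : ∀ {A : Set} (a? : Dec A) → does a? ≡ false → ¬ A
does-false (no ¬a) _ = ¬a

-- Connectivity and components in one colour.

module Structure
  (V : Set) (_≟_ : DecidableEquality V)
  (vertices : List V) (complete : ∀ v → v ∈ vertices)
  (side : V → Bool) (E : V → V → Bool) (E-sym : ∀ u v → E u v ≡ E v u)
  where

  private
    variable
      c : Bool
      S T   : V → Set

  Opp : V → V → Set
  Opp u v = side u ≢ side v

  Opp-sym : ∀ {u v} → Opp u v → Opp v u
  Opp-sym o p = o (sym p)

  _∪₁_ : (V → Set) → V → V → Set
  (S ∪₁ w) x = S x ⊎ x ≡ w

  Edge : Bool → (V → Set) → V → V → Set
  Edge c S u v = S u × S v × Opp u v × E u v ≡ c

  edge? : ∀ c → Decidable S → ∀ u v → Dec (Edge c S u v)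
  edge? c S? u v = S? u ×-dec S? v ×-dec ¬? (side u ≟ᵇ side v) ×-dec (E u v ≟ᵇ c)

  search : {Q : V → Set} → Decidable Q → (∃ Q) ⊎ (∀ v → ¬ Q v)
  search Q? with any? Q? vertices
  ... | yes q = let v , _ , p = find q in inj₁ (v , p)
  ... | no ¬q = inj₂ λ v p → ¬q (lose (complete v) p)

  searchEdge : ∀ c → Decidable S → (∃[ u ] ∃[ v ] Edge c S u v) ⊎ (∀ u v → ¬ Edge c S u v)
  searchEdge {S} c S? with search {Q = λ u → ∃[ v ] Edge c S u v} (λ u → hasEdge? u)
    where
    hasEdge? : ∀ u → Dec (∃[ v ] Edge c S u v)
    hasEdge? u with search (edge? c S? u)
    ... | inj₁ q = yes q
    ... | inj₂ q = no λ (v , p) → q v p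
  ... | inj₁ q = inj₁ q
  ... | inj₂ q = inj₂ λ u v p → q u (v , p)

  -- Cuts instead of walks: later arguments choose a cut and read off the crossing edge.
  Connected : Bool → (V → Set) → Set
  Connected c S = ∀ (T : V → Bool) x y → S x → S y → T x ≡ true → T y ≡ false →
    ∃[ u ] ∃[ v ] (Edge c S u v × T u ≡ true × T v ≡ false)

  Class : (V → Set) → (V → V) → V → V → Set
  Class S rep r x = S x × rep x ≡ r

  class? : Decidable S → (rep : V → V) (r : V) → Decidable (Class S rep r)
  class? S? rep r x = S? x ×-dec (rep x ≟ r)

  private
    relabel : V → V → V → V
    relabel a b z = if does (z ≟ b) then a else z

    relabel-old : ∀ a b → relabel a b b ≡ a
    relabel-old a b with b ≟ b
    ... | yes _ = refl
    ... | no ¬p = contradiction refl ¬p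

    relabel-new : ∀ a b → relabel a b a ≡ a
    relabel-new a b with a ≟ b
    ... | yes _ = refl
    ... | no _  = refl

    relabel-merges : ∀ a b p q → relabel a b p ≡ relabel a b q →
      (p ≡ q) ⊎ (p ≡ b × q ≡ a) ⊎ (p ≡ a × q ≡ b)
    relabel-merges a b p q eq with p ≟ b | q ≟ b
    ... | yes p≡b | yes q≡b = inj₁ (trans p≡b (sym q≡b))
    ... | yes p≡b | no _    = inj₂ (inj₁ (p≡b , sym eq))
    ... | no _    | yes q≡b = inj₂ (inj₂ (eq , q≡b))
    ... | no _    | no _    = inj₁ eq

    -- If `x` and `y` come from one old class, the cut is crossed there. Otherwise the new edge
    -- joins their classes, and the cut separates `x` from its near end, or its far end from `y`, or
    -- its two ends.
    merge-connected : ∀ c (S : V → Set) (rep : V → V) u w → Edge c S u w →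
      (∀ r → Connected c (Class S rep r)) →
      ∀ r → Connected c (Class S (relabel (rep u) (rep w) ∘ rep) r)
    merge-connected c S rep u w (Su , Sw , o , E≡c) conn r T x y (Sx , rx) (Sy , ry) Tx Ty
      = byCase (relabel-merges (rep u) (rep w) (rep x) (rep y) (trans rx (sym ry)))
      where
      rep′ = relabel (rep u) (rep w) ∘ rep
      Goal = ∃[ p ] ∃[ q ] (Edge c (Class S rep′ r) p q × T p ≡ true × T q ≡ false)
      within : ∀ {x y} → Class S rep′ r x → S y → rep y ≡ rep x → T x ≡ true → T y ≡ false → Goal
      within {x} {y} (Sx , rx) Sy y~x Tx Ty
        with conn (rep x) T x y (Sx , refl) (Sy , y~x) Tx Ty
      ... | p , q , ((Sp , rp) , (Sq , rq) , o , e) , Tp , Tq =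
        p , q , ((Sp , trans (cong (relabel _ _) rp) rx) ,
                 (Sq , trans (cong (relabel _ _) rq) rx) , o , e) , Tp , Tq
      across : ∀ {p q} → Edge c S p q → rep x ≡ rep p → rep y ≡ rep q → Goal
      across {p} {q} (Sp , Sq , o , e) xp yq with T p in Tp | T q in Tq
      ... | false | _     = within (Sx , rx) Sp (sym xp) Tx Tp
      ... | true  | true  = within (Sq , trans (cong (relabel _ _) (sym yq)) ry) Sy yq Tq Ty
      ... | true  | false =
        p , q , ((Sp , trans (cong (relabel _ _) (sym xp)) rx) ,
                 (Sq , trans (cong (relabel _ _) (sym yq)) ry) , o , e) , Tp , Tq
      byCase : _ → Goal
      byCase (inj₁ x~y)               = within (Sx , rx) Sy (sym x~y) Tx Ty
      byCase (inj₂ (inj₁ (xw , yu))) =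
        across (Sw , Su , Opp-sym o , trans (E-sym w u) E≡c) xw yu
      byCase (inj₂ (inj₂ (xu , yw))) = across (Su , Sw , o , E≡c) xu yw

    -- Union-find by relabelling: classes start as single vertices, and each listed edge merges the
    -- classes of its ends.
    mergeAll : ∀ c → Decidable S → (ps : List (V × V)) → Σ (V → V) λ rep →
      (∀ {u v} → (u , v) ∈ ps → Edge c S u v → rep u ≡ rep v) ×
      (∀ r → Connected c (Class S rep r))
    mergeAll c S? [] = (λ v → v) , (λ ()) ,
      λ { r T .r .r (_ , refl) (_ , refl) Tx Ty → contradiction (trans (sym Tx) Ty) λ () }
    mergeAll c S? ((u , w) ∷ ps) with mergeAll c S? ps | edge? c S? u w
    ... | rep , joins , conn | no ¬uw =
      rep , (λ { (here refl) uw → contradiction uw ¬uw ; (there i) → joins i }) , conn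
    ... | rep , joins , conn | yes uw =
      relabel (rep u) (rep w) ∘ rep ,
      (λ { (here refl) _ → trans (relabel-new (rep u) (rep w)) (sym (relabel-old (rep u) (rep w)))
         ; (there i) xy → cong (relabel _ _) (joins i xy) }) ,
      merge-connected c _ rep u w uw conn

  components : ∀ c → Decidable S → Σ (V → V) λ rep →
    (∀ {u v} → Edge c S u v → rep u ≡ rep v) × (∀ r → Connected c (Class S rep r))
  components c S? with mergeAll c S? (cartesianProduct vertices vertices)
  ... | rep , joins , conn =
    rep , (λ {u} {v} → joins (∈-cartesianProduct⁺ (complete u) (complete v))) , conn

  components-apart : ∀ c {rep : V → V} → (∀ {u v} → Edge c S u v → rep u ≡ rep v) →
    ∀ {u v} → S u → S v → Opp u v → rep u ≢ rep v → E u v ≡ not c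
  components-apart c joins Su Sv o ≢r = ¬-not λ e → ≢r (joins (Su , Sv , o , e))

  -- Levelwise separation and operations on splits.

  -- κ assigns to a vertex its ancestors in a bi-cotree, level by level, and the node labels
  -- alternate along the levels starting from c; Sep says that the lowest common ancestor of u
  -- and v predicts their adjacency correctly.
  Sep : Bool → ℕ → (ℕ → V → List V) → V → V → Set
  Sep c zero    κ u v = ⊥
  Sep c (suc h) κ u v = (κ 0 u ≢ κ 0 v × E u v ≡ c) ⊎
                        (κ 0 u ≡ κ 0 v × Sep (not c) h (κ ∘ suc) u v)

  Sep-cong : ∀ h {κ κ′ u v} → (∀ ℓ → κ ℓ u ≡ κ′ ℓ u) → (∀ ℓ → κ ℓ v ≡ κ′ ℓ v) →
    Sep c h κ u v → Sep c h κ′ u v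
  Sep-cong (suc h) p q (inj₁ (k≢ , e)) =
    inj₁ ((λ k≡ → k≢ (trans (p 0) (trans k≡ (sym (q 0))))) , e)
  Sep-cong (suc h) p q (inj₂ (k≡ , sep)) =
    inj₂ (trans (sym (p 0)) (trans k≡ (q 0)) , Sep-cong h (p ∘ suc) (q ∘ suc) sep)

  -- `key` takes both labels because every pair of parts has a bi-cotree of its own; the label of
  -- the `true` side comes first.
  record Split (c : Bool) (h : ℕ) (L : Set) (S : V → Set) : Set where
    field
      lab : V → L
      key : L → L → ℕ → V → List V
      sep : ∀ {u v} → S u → S v → side u ≡ true → side v ≡ false →
            Sep c h (key (lab u) (lab v)) u v
  open Split

  private
    opp : ∀ {u v} → side u ≡ true → side v ≡ false → Opp u v
    opp su sv eq = contradiction (trans (sym su) (trans eq sv)) λ ()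

    Opp⇒≢ : ∀ {u v} → Opp u v → u ≢ v
    Opp⇒≢ o refl = o refl

  -- Of two consecutive levels one carries the label `e`; the vertices are separated there, after a
  -- common key if it is the second.
  homogeneous : ∀ c e h {L : Set} → L → (∀ {u v} → S u → S v → Opp u v → E u v ≡ e) →
    Split c (suc (suc h)) L S
  homogeneous {S} c e h l hom = record { lab = λ _ → l ; key = λ _ _ → κ ; sep = sepκ }
    where
    κ : ℕ → V → List V
    κ zero    v = if does (e ≟ᵇ c) then v ∷ [] else []
    κ (suc _) v = v ∷ []
    sepκ : ∀ {u v} → S u → S v → side u ≡ true → side v ≡ false → Sep c (suc (suc h)) κ u v
    sepκ Su Sv su sv with e ≟ᵇ c
    ... | yes refl = inj₁ (Opp⇒≢ (opp su sv) ∘ ∷-injectiveˡ , hom Su Sv (opp su sv))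
    ... | no e≢c = inj₂ (refl , inj₁ (Opp⇒≢ (opp su sv) ∘ ∷-injectiveˡ ,
                                      trans (hom Su Sv (opp su sv)) (¬-not e≢c)))

  module _ {c : Bool} {h : ℕ} {L : Set} {S : V → Set} (rep : V → V)
    (apart : ∀ {u v} → S u → S v → Opp u v → rep u ≢ rep v → E u v ≡ c)
    where

    -- The new level already settles pairs from different classes, so all classes can reuse the same
    -- labels.
    splitLevel : (∀ r → Split (not c) h L (Class S rep r)) → Split c (suc h) L S
    splitLevel g = record { lab = λ v → lab (g (rep v)) v ; key = κ ; sep = sepκ }
      where
      κ : L → L → ℕ → V → List V
      κ i j zero    v = rep v ∷ []
      κ i j (suc ℓ) v = key (g (rep v)) i j ℓ v
      sepκ : ∀ {u v} → S u → S v → side u ≡ true → side v ≡ false →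
        Sep c (suc h) (κ (lab (g (rep u)) u) (lab (g (rep v)) v)) u v
      sepκ {u} {v} Su Sv su sv with rep u ≟ rep v
      ... | no r≢ = inj₁ (r≢ ∘ ∷-injectiveˡ , apart Su Sv (opp su sv) r≢)
      ... | yes r≡ = inj₂ (cong (_∷ []) r≡ , subst
        (λ r → Sep (not c) h (λ ℓ → κ (lab (g (rep u)) u) (lab (g r) v) (suc ℓ)) u v) r≡
        (Sep-cong h (λ ℓ → refl)
          (λ ℓ → cong (λ r → key (g r) (lab (g (rep u)) u) (lab (g (rep u)) v) ℓ v) r≡)
          (sep (g (rep u)) (Su , refl) (Sv , sym r≡) su sv)))

    -- No level is added: pairs from different classes have the colour `c` of the first level, so it
    -- is enough to prefix the class to its key.
    splitUnion : (∀ r → Split c (suc h) L (Class S rep r)) → Split c (suc h) L S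
    splitUnion g = record { lab = λ v → lab (g (rep v)) v ; key = κ ; sep = sepκ }
      where
      κ : L → L → ℕ → V → List V
      κ i j zero    v = rep v ∷ key (g (rep v)) i j 0 v
      κ i j (suc ℓ) v = key (g (rep v)) i j (suc ℓ) v
      sepκ : ∀ {u v} → S u → S v → side u ≡ true → side v ≡ false →
        Sep c (suc h) (κ (lab (g (rep u)) u) (lab (g (rep v)) v)) u v
      sepκ {u} {v} Su Sv su sv with rep u ≟ rep v
      ... | no r≢ = inj₁ (r≢ ∘ ∷-injectiveˡ , apart Su Sv (opp su sv) r≢)
      ... | yes r≡ = subst (λ r → Sep c (suc h) (κ (lab (g (rep u)) u) (lab (g r) v)) u v) r≡
        (prefix (Sep-cong (suc h) {key (g (rep u)) _ _} {λ ℓ x → key (g (rep x)) _ _ ℓ x} (λ ℓ → refl)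
          (λ ℓ → cong (λ r → key (g r) (lab (g (rep u)) u) (lab (g (rep u)) v) ℓ v) r≡)
          (sep (g (rep u)) (Su , refl) (Sv , sym r≡) su sv)))
        where
        prefix : ∀ {i j} → Sep c (suc h) (λ ℓ x → key (g (rep x)) i j ℓ x) u v →
          Sep c (suc h) (κ i j) u v
        prefix (inj₁ (k≢ , e))  = inj₁ (k≢ ∘ ∷-injectiveʳ , e)
        prefix (inj₂ (k≡ , sp)) = inj₂ (cong₂ _∷_ r≡ k≡ , sp)

  -- The sets for `e` and `not e` share the side of `a`; only the other side is divided between
  -- them.
  Toward : Bool → V → (V → Set) → V → Set
  Toward e a S x = S x × (side x ≡ side a ⊎ E a x ≡ e)

  toward? : ∀ e a → Decidable S → Decidable (Toward e a S)
  toward? e a S? x = S? x ×-dec (side x ≟ᵇ side a ⊎-dec E a x ≟ᵇ e)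

  toward-uniform : ∀ S {e a x} → Toward e a S x → Opp a x → E a x ≡ e
  toward-uniform _ (_ , inj₁ p) o = contradiction (sym p) o
  toward-uniform _ (_ , inj₂ p) o = p

  -- Every opposite pair lies in one of the two sets, as its vertex on the side of `a` lies in both.
  -- That vertex needs a label for each, and the bit of the other one selects the split.
  splitBy : ∀ {c h} e a {L L′ : Set} → Split c h L (Toward e a S) →
    Split c h L′ (Toward (not e) a S) → Split c h (L × L′ × Bool) S
  splitBy {S} {c} {h} e a {L} {L′} g g′ = record
    { lab = label ; key = κ ; sep = sepκ }
    where
    label : V → L × L′ × Bool
    label v = lab g v , lab g′ v , does (E a v ≟ᵇ e)
    κ : L × L′ × Bool → L × L′ × Bool → ℕ → V → List V
    κ (i , i′ , b) (j , j′ , b′) =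
      if (if side a then b′ else b) then key g i j else key g′ i′ j′
    sepκ : ∀ {u v} → S u → S v → side u ≡ true → side v ≡ false →
      Sep c h (κ (label u) (label v)) u v
    sepκ {u} {v} Su Sv su sv = onSide (side a) refl
      where
      onSide : ∀ d → side a ≡ d →
        Sep c h (if (if d then does (E a v ≟ᵇ e) else does (E a u ≟ᵇ e))
                 then key g (lab g u) (lab g v) else key g′ (lab g′ u) (lab g′ v)) u v
      onSide true sa with E a v ≟ᵇ e
      ... | yes p = sep g (Su , inj₁ (trans su (sym sa))) (Sv , inj₂ p) su sv
      ... | no ¬p = sep g′ (Su , inj₁ (trans su (sym sa))) (Sv , inj₂ (¬-not ¬p)) su sv
      onSide false sa with E a u ≟ᵇ e
      ... | yes p = sep g (Su , inj₂ p) (Sv , inj₁ (trans sv (sym sa))) su sv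
      ... | no ¬p = sep g′ (Su , inj₂ (¬-not ¬p)) (Sv , inj₁ (trans sv (sym sa))) su sv

  -- Chains and half-graphs.

  Uniform : Bool → V → (V → Set) → Set
  Uniform e w T = ∀ {v} → T v → Opp w v → E w v ≡ e

  -- A half-graph built from the outside in, above the set T: n vertices whose sides alternate,
  -- each joined in a colour determined by its side to all later vertices and to T. The last
  -- vertex has colour e, and s records which side carries which colour.
  Chain : Bool → Bool → ℕ → (V → Set) → Set
  Chain s e zero    T = ⊤
  Chain s e (suc n) T =
    Σ V λ w → side w xor e ≡ s × Uniform e w T × Chain s (not e) n (T ∪₁ w)

  chain-mono : ∀ {s e} n {S T} → (∀ {x} → T x → S x) → Chain s e n S → Chain s e n T
  chain-mono zero    T⊆S _ = tt
  chain-mono (suc n) T⊆S (w , s≡ , uni , ch) = w , s≡ , uni ∘ T⊆S ,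
    chain-mono n (λ { (inj₁ p) → inj₁ (T⊆S p) ; (inj₂ p) → inj₂ p }) ch

  -- The chain above `S` is also one above `T` together with `w`, both being inside `S`.
  chain-add : ∀ {s e e′ n S T w} → (∀ {x} → T x → S x) → S w → side w xor e ≡ s →
    Uniform e w T → e′ ≡ not e → Chain s e′ n S → Chain s e (suc n) T
  chain-add {n = n} {w = w} T⊆S Sw s≡ uni refl ch = w , s≡ , uni ,
    chain-mono n (λ { (inj₁ p) → T⊆S p ; (inj₂ refl) → Sw }) ch

  -- Since `x` and `y` lie on opposite sides, exactly one of them has type `s` with colour `e`. It
  -- goes last, preceded by the other with colour `not e`, the colour of the edge.
  chain-close : ∀ {s e n S x y} → Edge (not e) S x y → Chain s e n S →
    Chain s e (suc (suc n)) (λ _ → ⊥)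
  chain-close {s} {e} {n} {S} {x} {y} (Sx , Sy , o , E≡) ch with (side y xor e) ≟ᵇ s
  ... | yes y≡ = chain-add {e = e} {S = λ v → v ≡ y} (λ ()) refl y≡ (λ ()) refl
    (chain-add {e = not e} {S = S} (λ { refl → Sy }) Sx (trans (xor-opp e o) y≡)
      (λ { refl _ → E≡ }) (sym (not-involutive e)) ch)
  ... | no y≢ = chain-add {e = e} {S = λ v → v ≡ x} (λ ()) refl x≡ (λ ()) refl
    (chain-add {e = not e} {S = S} (λ { refl → Sx }) Sy (trans (xor-opp e (Opp-sym o)) x≡)
      (λ { refl _ → trans (E-sym y x) E≡ }) (sym (not-involutive e)) ch)
    where
    x≡ : side x xor e ≡ s
    x≡ = ≢-≢⇒≡ (xor-differ e o) (y≢ ∘ sym)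

  record HalfGraph (s : Bool) (k : ℕ) (T : V → Set) : Set where
    field
      lower  : Fin k → V
      upper  : Fin k → V
      lower-side : ∀ i → side (lower i) ≡ s
      upper-side : ∀ i → side (upper i) ≡ not s
      lower-upper : ∀ i j → E (lower i) (upper j) ≡ (toℕ i ≤ᵇ toℕ j)
      lower-out : ∀ i → Uniform false (lower i) T
      upper-out : ∀ i → Uniform true (upper i) T

  private
    xor-false : ∀ {b s} → b xor false ≡ s → b ≡ s
    xor-false {true}  p = p
    xor-false {false} p = p

    xor-true : ∀ {b s} → b xor true ≡ s → b ≡ not s
    xor-true {true}  refl = refl
    xor-true {false} refl = refl

    ≡not⇒≢ : ∀ {a b s : Bool} → a ≡ s → b ≡ not s → a ≢ b
    ≡not⇒≢ refl refl eq = not-¬ refl eq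

  -- Pairs are indexed from the inside out: the last vertex, of colour `false`, becomes
  -- `lower zero`, and the one before it `upper zero`.
  chain⇒halfGraph : ∀ {s} k {n T} → double k ≤ n → Chain s false n T → HalfGraph s k T
  chain⇒halfGraph zero _ _ = record
    { lower = λ () ; upper = λ () ; lower-side = λ () ; upper-side = λ ()
    ; lower-upper = λ () ; lower-out = λ () ; upper-out = λ () }
  chain⇒halfGraph {s} (suc k) {T = T} (s≤s (s≤s le)) (b , bs , bT , a , as , aT , ch) = record
    { lower = λ { zero → b ; (suc i) → lower i }
    ; upper = λ { zero → a ; (suc i) → upper i }
    ; lower-side = λ { zero → xor-false bs ; (suc i) → lower-side i }
    ; upper-side = λ { zero → xor-true as ; (suc i) → upper-side i }
    ; lower-upper = λ
      { zero zero → trans (E-sym b a) (aT (inj₂ refl) (Opp-sym (≡not⇒≢ (xor-false bs) (xor-true as))))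
      ; zero (suc j) → trans (E-sym b (upper j)) (upper-out j (inj₁ (inj₂ refl))
                         (Opp-sym (≡not⇒≢ (xor-false bs) (upper-side j))))
      ; (suc i) zero → lower-out i (inj₂ refl) (≡not⇒≢ (lower-side i) (xor-true as))
      ; (suc i) (suc j) → trans (lower-upper i j) (≤ᵇ-suc (toℕ i) (toℕ j)) }
    ; lower-out = λ { zero → bT ; (suc i) → λ p → lower-out i (inj₁ (inj₁ p)) }
    ; upper-out = λ { zero → λ p → aT (inj₁ p) ; (suc i) → λ p → upper-out i (inj₁ (inj₁ p)) }
    }
    where
    open HalfGraph (chain⇒halfGraph k le ch)
    ≤ᵇ-suc : ∀ x y → (x ≤ᵇ y) ≡ (suc x ≤ᵇ suc y)
    ≤ᵇ-suc zero    y = refl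
    ≤ᵇ-suc (suc x) y = refl

  module _ {s : Bool} {k : ℕ} {T : V → Set} (h : HalfGraph s k T) where
    open HalfGraph h

    private
      ≤ᵇ-refl : ∀ i → (i ≤ᵇ i) ≡ true
      ≤ᵇ-refl i = Equivalence.to T-≡ (≤⇒≤ᵇ (≤-refl {i}))

      ≤ᵇ-antisym : ∀ {i j : Fin k} → (toℕ i ≤ᵇ toℕ j) ≡ true → (toℕ j ≤ᵇ toℕ i) ≡ true → i ≡ j
      ≤ᵇ-antisym p q = Fin.toℕ-injective
        (≤-antisym (≤ᵇ⇒≤ _ _ (Equivalence.from T-≡ p)) (≤ᵇ⇒≤ _ _ (Equivalence.from T-≡ q)))

    -- Distinctness is not recorded in a chain but follows from adjacency: if `lower i` is
    -- `lower j`, its edge to `upper j` gives `i ≤ j`, and by symmetry `j ≤ i`.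
    lower-injective : ∀ {i j} → lower i ≡ lower j → i ≡ j
    lower-injective eq = ≤ᵇ-antisym (below eq) (below (sym eq))
      where
      below : ∀ {i j} → lower i ≡ lower j → (toℕ i ≤ᵇ toℕ j) ≡ true
      below {i} {j} eq = trans (sym (lower-upper i j))
        (trans (cong (λ v → E v (upper j)) eq) (trans (lower-upper j j) (≤ᵇ-refl (toℕ j))))

    upper-injective : ∀ {i j} → upper i ≡ upper j → i ≡ j
    upper-injective eq = ≤ᵇ-antisym (below eq) (below (sym eq))
      where
      below : ∀ {i j} → upper i ≡ upper j → (toℕ i ≤ᵇ toℕ j) ≡ true
      below {i} {j} eq = trans (sym (lower-upper i j))
        (trans (cong (E (lower i)) (sym eq)) (trans (lower-upper i i) (≤ᵇ-refl (toℕ i))))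

  -- Induced paths.

  -- Induced paths with n + 1 vertices; only the last one, u, may be joined to C in colour c.
  Path : Bool → ℕ → V → (V → Set) → Set
  Path c zero    u C = ⊤
  Path c (suc n) u C =
    Σ V λ v → Path c n v (C ∪₁ u) × Opp u v × E u v ≡ c × Uniform (not c) v C

  path-mono : ∀ {c} n {u C C′} → (∀ {x} → C′ x → C x) → Path c n u C → Path c n u C′
  path-mono zero    C′⊆C _ = tt
  path-mono (suc n) C′⊆C (v , p , o , e , uni) = v ,
    path-mono n (λ { (inj₁ q) → inj₁ (C′⊆C q) ; (inj₂ q) → inj₂ q }) p , o , e , uni ∘ C′⊆C

  parity : ℕ → Bool
  parity zero    = false
  parity (suc n) = not (parity n)

  -- Positions run backwards from the end `u`, so that extending the path shifts them by one.
  -- Positions of equal parity lie on one side, where `E` is unconstrained.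
  record PathMap (c : Bool) (n : ℕ) (u : V) (C : V → Set) : Set where
    field
      at      : ℕ → V
      at-zero : at 0 ≡ u
      at-side : ∀ {x} → x ≤ n → side (at x) ≡ parity x xor side u
      at-near : ∀ {x y} → x ≤ n → y ≤ n → parity x ≢ parity y →
                E (at x) (at y) ≡ (if near x y then c else not c)
      at-out  : ∀ {x} → suc x ≤ n → Uniform (not c) (at (suc x)) C

  path⇒map : ∀ {c} n {u C} → Path c n u C → PathMap c n u C
  path⇒map zero {u} _ = record
    { at = λ _ → u ; at-zero = refl ; at-side = λ { z≤n → refl }
    ; at-near = λ { z≤n z≤n o → contradiction refl o } ; at-out = λ () }
  path⇒map {c} (suc n) {u} {C} (v , p , o , e , uni) = record
    { at = f ; at-zero = refl ; at-side = λ { {zero} _ → refl ; {suc x} (s≤s le) → f-side x le }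
    ; at-near = f-near ; at-out = f-out }
    where
    open PathMap (path⇒map n p)
    f : ℕ → V
    f zero    = u
    f (suc x) = at x
    f-side : ∀ x → x ≤ n → side (at x) ≡ not (parity x) xor side u
    f-side x le = trans (at-side le) (trans (cong (parity x xor_) (¬-not (Opp-sym o))) (flip (parity x)))
      where
      flip : ∀ b → b xor not (side u) ≡ not b xor side u
      flip true  = not-involutive (side u)
      flip false = refl
    f-out : ∀ {x} → suc x ≤ suc n → Uniform (not c) (at x) C
    f-out {zero}  _        rewrite at-zero = uni
    f-out {suc x} (s≤s le) Cz = at-out le (inj₁ Cz)
    from-u : ∀ y → y ≤ n → true ≢ parity y → E u (at y) ≡ (if near 0 (suc y) then c else not c)
    from-u zero _ _ rewrite at-zero = e
    -- Everything behind `v` is uniform in `not c` to `C ∪₁ u`, hence joined to `u` in `not c`.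
    from-u (suc y) le ≢p = trans (E-sym u (at (suc y))) (at-out le (inj₂ refl) opp-u)
      where
      opp-u : Opp (at (suc y)) u
      opp-u eq = ≢p (flip (parity (suc y)) (trans (sym (f-side (suc y) le)) eq))
        where
        flip : ∀ b → not b xor side u ≡ side u → true ≡ b
        flip true  _ = refl
        flip false p = contradiction (sym p) (not-¬ refl)
    near-sym : ∀ x y → near x y ≡ near y x
    near-sym zero    zero    = refl
    near-sym zero    (suc y) = refl
    near-sym (suc x) zero    = refl
    near-sym (suc x) (suc y) = near-sym x y
    f-near : ∀ {x y} → x ≤ suc n → y ≤ suc n → parity x ≢ parity y →
      E (f x) (f y) ≡ (if near x y then c else not c)
    f-near {zero}  {zero}  _ _ ≢p = contradiction refl ≢p
    f-near {zero}  {suc y} _ (s≤s le) ≢p = from-u y le (λ p → ≢p (cong not p))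
    f-near {suc x} {zero}  (s≤s le) _ ≢p = trans (E-sym (at x) u)
      (trans (from-u x le (λ p → ≢p (cong not (sym p))))
             (cong (if_then c else not c) (near-sym 0 (suc x))))
    f-near {suc x} {suc y} (s≤s lx) (s≤s ly) ≢p = at-near lx ly (≢p ∘ cong not)

  private
    near-self : ∀ y → near (suc y) y ≡ true
    near-self zero    = refl
    near-self (suc y) = near-self y

    near-beyond : ∀ {x y} → x < y → near (suc y) x ≡ false
    near-beyond {zero}  (s≤s z≤n) = refl
    near-beyond {suc x} (s≤s lt)  = near-beyond lt

  module _ {c : Bool} {n : ℕ} {u : V} {C : V → Set} (M : PathMap c n u C) where
    open PathMap M

    -- The vertex at y has a neighbour at y + 1 that is not a neighbour of the vertex at x.
    at-distinct : ∀ {x y} → x < y → y < n → parity x ≡ parity y → at x ≢ at y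
    at-distinct {x} {y} x<y y<n p≡ eq = not-¬ refl (trans (sym joined) apart)
      where
      joined : E (at (suc y)) (at y) ≡ c
      joined = trans (at-near y<n (<⇒≤ y<n) (not-¬ refl ∘ sym))
        (cong (if_then c else not c) (near-self y))
      apart : E (at (suc y)) (at y) ≡ not c
      apart = trans (cong (E (at (suc y))) (sym eq))
        (trans (at-near y<n (<⇒≤ (≤-trans x<y (<⇒≤ y<n))) (λ q → not-¬ refl (sym (trans q p≡))))
          (cong (if_then c else not c) (near-beyond x<y)))

    at-injective : ∀ {x y} → x < n → y < n → parity x ≡ parity y → at x ≡ at y → x ≡ y
    at-injective {x} {y} x<n y<n p≡ eq with <-cmp x y
    ... | tri< x<y _ _ = contradiction eq (at-distinct x<y y<n p≡)
    ... | tri≈ _ x≡y _ = x≡y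
    ... | tri> _ _ y<x = contradiction (sym eq) (at-distinct y<x x<n (sym p≡))

  -- Progress on the two chains.

  -- Colours alternate in the recursion. A step in colour c is sure to lengthen a chain only if
  -- one of the two chains does not already end in c, so it starts from l = not c.
  record State (K : ℕ) (l : Bool) (r : ℕ) (S : V → Set) : Set where
    field
      {s₀ s₁ e₁} : Bool
      {n₀ n₁}    : ℕ
      differ     : s₁ ≢ s₀
      chain₀     : Chain s₀ l n₀ S
      chain₁     : Chain s₁ e₁ n₁ S
      long       : K ≤ n₀ + n₁ + r

  -- Passing to a set T on which both v and its non-neighbour a are uniform lengthens a chain:
  -- if v cannot be appended to the chain of its type, then either a can be put between that
  -- chain and v, or a can be appended to the other chain.
  advance : ∀ {K c r S T v a e} → State K (not c) (suc r) S → S v → S a →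
    Opp v a → E v a ≡ not c → (∀ {x} → T x → S x) → Uniform c v T → Uniform e a T →
    State K c r T
  advance {K} {c} {r} {S} {T} {v} {a} {e} st Sv Sa o va T⊆S vT aT
    with (side v xor c) ≟ᵇ State.s₀ st
  ... | yes v₀ = record
    { differ = differ
    ; chain₀ = chain-add {e = c} {S = S} T⊆S Sv v₀ vT refl chain₀
    ; chain₁ = chain-mono n₁ T⊆S chain₁
    ; long   = ≤-trans long (≤-reflexive (+-suc (n₀ + n₁) r)) }
    where open State st
  ... | no v≢ with State.e₁ st ≟ᵇ c | e ≟ᵇ c
  ... | no e≢ | _ = record
    { differ = differ ∘ sym
    ; chain₀ = chain-add {e = c} {S = S} T⊆S Sv (≢-≢⇒≡ v≢ differ) vT (¬-not e≢) chain₁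
    ; chain₁ = chain-mono n₀ T⊆S chain₀
    ; long   = ≤-trans long (≤-reflexive (trans (+-suc (n₀ + n₁) r)
                 (cong (λ n → suc (n + r)) (+-comm n₀ n₁)))) }
    where open State st
  ... | yes refl | yes refl = record
    { differ = differ ∘ sym
    ; chain₀ = chain-mono n₁ T⊆S chain₁
    ; chain₁ = chain-add {e = c} {S = S} T⊆S Sa
        (≢-≢⇒≡ (xor-differ c (Opp-sym o)) (v≢ ∘ sym)) aT refl chain₀
    ; long   = ≤-trans long (≤-reflexive (trans (+-suc (n₀ + n₁) r)
                 (cong (_+ r) (trans (cong suc (+-comm n₀ n₁)) (sym (+-suc n₁ n₀)))))) }
    where open State st
  ... | yes refl | no e≢ = record
    { differ = differ ∘ sym
    ; chain₀ = chain-add {e = c} {S = T ∪₁ v} inj₁ (inj₂ refl) v₁ vT refl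
        (chain-add {e = not c} {S = S} (λ { (inj₁ p) → T⊆S p ; (inj₂ refl) → Sv }) Sa
          (trans (xor-opp c (Opp-sym o)) v₁)
          (λ { (inj₁ p) o′ → trans (aT p o′) (¬-not e≢)
             ; (inj₂ refl) _ → trans (E-sym a v) va })
          (sym (not-involutive c)) chain₁)
    ; chain₁ = chain-mono n₀ T⊆S chain₀
    ; long   = ≤-trans long (≤-trans (≤-reflexive (trans (+-suc (n₀ + n₁) r)
                 (cong (λ n → suc (n + r)) (+-comm n₀ n₁)))) (n≤1+n _)) }
    where
    open State st
    v₁ : side v xor c ≡ s₁
    v₁ = ≢-≢⇒≡ v≢ differ

  -- The recursive decomposition.

  module Decompose (t d K : ℕ) (d≤K : d + d ≤ 3 + K)
    (noPath : ∀ c v C → ¬ Path c t v C)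
    (noChain : ∀ s e n → suc d ≤ n → ¬ Chain s e n (λ _ → ⊥))
    where

    -- A pair of colour `not e` in `S` would close the chain to at least `suc d` vertices.
    chain⇒homogeneous : ∀ {s e n} c → Decidable S → d ≤ suc n → Chain s e n S →
      Split c 2 ⊤ S
    chain⇒homogeneous {S} {s} {e} {n} c S? le ch with searchEdge (not e) S?
    ... | inj₁ (x , y , xy) = ⊥-elim (noChain s e _ (s≤s le) (chain-close xy ch))
    ... | inj₂ none = homogeneous c e 0 tt hom
      where
      hom : ∀ {u v} → S u → S v → Opp u v → E u v ≡ e
      hom Su Sv o = trans (¬-not λ e≡ → none _ _ (Su , Sv , o , e≡)) (not-involutive e)

    module Search (c : Bool) (h : ℕ) (L : Labels) (D : V → Set)
      (connD : Connected (not c) D)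
      (uniformCase : ∀ {T : V → Set} → Decidable T → (∀ {x} → T x → D x) → ∀ {v a} → D v → D a →
        Opp v a → E v a ≡ not c → Uniform c v T → Split (not c) (suc (suc h)) ⟦ mux L L ⟧ T)
      where

      -- The cut around `v` alone is crossed by an edge of colour `not c`, which must start at `v`.
      nonNeighbour : ∀ {v z} → D v → D z → Opp v z → ∃[ a ] (D a × Opp v a × E v a ≡ not c)
      nonNeighbour {v} {z} Dv Dz o with connD (λ x → does (x ≟ v)) v z Dv Dz
        (dec-true (v ≟ v) refl) (dec-false (z ≟ v) (Opp⇒≢ (Opp-sym o)))
      ... | u , a , (Du , Da , o′ , e) , u≟v , _ with does-true (u ≟ v) u≟v
      ... | refl = a , Da , o′ , e

      -- `f` is fuel, and `n + f ≡ t` makes it run out only at an excluded path. `z` witnesses that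
      -- `C` is attached to the end `v`.
      alongPath : ∀ f n → n + f ≡ t → ∀ {v z C} → Decidable C → (∀ {x} → C x → D x) → D v →
        Connected c C → Path c n v C → C z → Opp v z → E v z ≡ c →
        Split (not c) (suc (suc h)) ⟦ searchLabels f L ⟧ C
      alongPath zero n n≡t {v} {C = C} _ _ _ _ path _ _ _ =
        ⊥-elim (noPath c v C (subst (λ n → Path c n v C) (trans (sym (+-identityʳ n)) n≡t) path))
      alongPath (suc f) n n≡t {v} {z} {C} C? C⊆D Dv connC path Cz o vz =
        splitBy c v
          (let a , Da , oa , va = nonNeighbour Dv (C⊆D Cz) o in
           uniformCase (toward? c v C?) (C⊆D ∘ proj₁) Dv Da oa va (toward-uniform C))
          (splitUnion rep (components-apart c joins) ofComponent)
        where
        W = Toward (not c) v C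
        W? = toward? (not c) v C?
        comps = components c W?
        rep = proj₁ comps
        joins : ∀ {x y} → Edge c W x y → rep x ≡ rep y
        joins = proj₁ (proj₂ comps)
        C′ = Class W rep
        C′? = class? W? rep
        z∉W : ¬ W z
        z∉W Wz = not-¬ vz (toward-uniform C Wz o)
        -- The cut `C′ r` of `C` leaves out `z`, which is not in `W`. The crossing edge ends outside
        -- `W`, since otherwise `joins` would put its far end into `C′ r`.
        entrance : ∀ r {x} → C′ r x → ∃[ y ] ∃[ w ]
          (C′ r y × C w × ¬ W w × Opp w y × E w y ≡ c)
        entrance r {x} C′x
          with connC (λ q → does (C′? r q)) x z (proj₁ (proj₁ C′x)) Cz
            (dec-true (C′? r x) C′x) (dec-false (C′? r z) (z∉W ∘ proj₁))
        ... | y , w , (_ , Cw , yw , e) , y∈ , w∉ with does-true (C′? r y) y∈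
        ... | Wy , ry = y , w , (Wy , ry) , Cw ,
          (λ Ww → does-false (C′? r w) w∉ (Ww , trans (sym (joins (Wy , Ww , yw , e))) ry)) ,
          Opp-sym yw , trans (E-sym w y) e
        ofComponent : ∀ r → Split (not c) (suc (suc h)) ⟦ searchLabels f L ⟧ (C′ r)
        ofComponent r with searchEdge c (C′? r)
        -- Without an edge of colour `c` no work is left, and any label serves.
        ... | inj₂ none = homogeneous (not c) (not c) h (someLabel (searchLabels f L))
          λ Cu Cv o → ¬-not λ e → none _ _ (Cu , Cv , o , e)
        ... | inj₁ (x , _ , C′x , _) with entrance r C′x
        ... | y , w , C′y , Cw , ¬Ww , wy , e =
          -- `w` lies in `C` outside `W`, so it is opposite to `v` and joined to it in colour `c`:
          -- it becomes the new end, while `v` is uniform in `not c` to the component, which lies in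
          -- `W`.
          alongPath f (suc n) (trans (sym (+-suc n f)) n≡t) (C′? r) (C⊆D ∘ C′⊆C) (C⊆D Cw)
            (proj₂ (proj₂ comps) r)
            (v , path-mono n (λ { (inj₁ p) → C′⊆C p ; (inj₂ refl) → Cw }) path ,
             w-v , trans (E-sym w v) v-w , toward-uniform C ∘ proj₁)
            C′y wy e
          where
          C′⊆C : ∀ {x} → C′ r x → C x
          C′⊆C = proj₁ ∘ proj₁
          w-v : Opp w v
          w-v p = ¬Ww (Cw , inj₁ p)
          v-w : E v w ≡ c
          v-w = trans (¬-not λ e → ¬Ww (Cw , inj₂ e)) (not-involutive c)

      connectedCase : Decidable D →
        Split (not c) (suc (suc h)) ⟦ searchLabels t L ⟧ D
      connectedCase D? = splitUnion rep (components-apart c joins) ofComponent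
        where
        comps = components c D?
        rep = proj₁ comps
        joins : ∀ {x y} → Edge c D x y → rep x ≡ rep y
        joins = proj₁ (proj₂ comps)
        ofComponent : ∀ r → Split (not c) (suc (suc h)) ⟦ searchLabels t L ⟧ (Class D rep r)
        ofComponent r with searchEdge c (class? D? rep r)
        ... | inj₂ none = homogeneous (not c) (not c) h (someLabel (searchLabels t L))
          λ Cu Cv o → ¬-not λ e → none _ _ (Cu , Cv , o , e)
        -- The path starts as the single vertex `v`, which itself lies in the component.
        ... | inj₁ (v , z , (Dv , _) , Cz , o , e) =
          alongPath t 0 refl (class? D? rep r) proj₁ Dv (proj₂ (proj₂ comps) r) tt Cz o e

    -- `r` counts the steps left. Each takes one level and lengthens a chain, and two levels remain
    -- for the homogeneous sets at the end.
    decompose : ∀ r c → Decidable S → State K (not c) r S →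
      Split c (suc (suc r)) ⟦ splitLabels t r ⟧ S
    decompose zero c S? st with d ≤? suc (State.n₀ st) | d ≤? suc (State.n₁ st)
    ... | yes le | _      = chain⇒homogeneous c S? le (State.chain₀ st)
    ... | no _   | yes le = chain⇒homogeneous c S? le (State.chain₁ st)
    -- Otherwise `n₀ + n₁ + 4 ≤ d + d ≤ 3 + K ≤ 3 + n₀ + n₁`.
    ... | no n≰₀ | no n≰₁ = contradiction
      (≤-trans (+-mono-≤ (≰⇒> n≰₀) (≰⇒> n≰₁)) (≤-trans d≤K (s≤s (s≤s (s≤s
        (≤-trans long (≤-reflexive (+-identityʳ (n₀ + n₁)))))))))
      (λ le → n≮n _ (≤-trans (≤-reflexive (sym (trans (+-suc n₀ (suc n₁)) (cong suc (+-suc n₀ n₁)))))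
        (≤-pred (≤-pred le))))
      where open State st
    decompose {S} (suc r) c S? st =
      splitLevel rep
        (λ Su Sv o ≢r → trans (components-apart (not c) joins Su Sv o ≢r) (not-involutive c))
        λ q → Search.connectedCase c r (splitLabels t r) (Class S rep q) (proj₂ (proj₂ comps) q)
          (uniformCase q) (class? S? rep q)
      where
      comps = components (not c) S?
      rep = proj₁ comps
      joins : ∀ {x y} → Edge (not c) S x y → rep x ≡ rep y
      joins = proj₁ (proj₂ comps)
      uniformCase : ∀ q {T} → Decidable T → (∀ {x} → T x → Class S rep q x) → ∀ {v a} →
        Class S rep q v → Class S rep q a → Opp v a → E v a ≡ not c → Uniform c v T →
        Split (not c) (suc (suc r)) ⟦ mux (splitLabels t r) (splitLabels t r) ⟧ T
      uniformCase q {T} T? T⊆D {v} {a} (Sv , _) (Sa , _) o va vT =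
        -- Both halves are handled alike: `advance` gains whichever colour joins `a` to the half.
        splitBy true a (part true) (part false)
        where
        part : ∀ e → Split (not c) (suc (suc r)) ⟦ splitLabels t r ⟧ (Toward e a T)
        part e = decompose r (not c) (toward? e a T?)
          (subst (λ l → State K l r (Toward e a T)) (sym (not-involutive c))
            (advance st Sv Sa o va (proj₁ ∘ T⊆D ∘ proj₁) (vT ∘ proj₁) (toward-uniform T)))

  -- Trees from keys.

  record DistinctValues {K : Set} (f : V → K) (S : V → Set) : Set where
    field
      count     : ℕ
      value     : Fin count → K
      injective : ∀ {i j} → value i ≡ value j → i ≡ j
      attained  : ∀ i → ∃[ v ] (S v × f v ≡ value i)
      covers    : ∀ {v} → S v → ∃[ i ] f v ≡ value i

  -- Used twice: the values become the children of a tree node and the nonempty parts of the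
  -- cosplit.
  distinctValues : {K : Set} → DecidableEquality K → (f : V → K) → Decidable S → DistinctValues f S
  distinctValues {S} {K} _≟ᵏ_ f S? = record
    { count = count ; value = value ; injective = injective
    ; attained = λ i → let v , (_ , Sv) , eq = attained i in v , Sv , eq
    ; covers = λ Sv → covers (complete _ , Sv) }
    where
    among : (ys : List V) → DistinctValues f (λ v → v ∈ ys × S v)
    among [] = record { count = 0 ; value = λ () ; injective = λ {} ; attained = λ () ; covers = λ () }
    among (y ∷ ys) with S? y | among ys
    ... | no ¬Sy | D = record
      { count = count D ; value = value D ; injective = injective D
      ; attained = λ i → let v , (v∈ , Sv) , eq = attained D i in v , (there v∈ , Sv) , eq
      ; covers = λ { (here refl , Sy) → contradiction Sy ¬Sy ; (there v∈ , Sv) → covers D (v∈ , Sv) } }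
      where open DistinctValues
    ... | yes Sy | D with Fin.any? (λ i → f y ≟ᵏ DistinctValues.value D i)
    ... | yes known = record
      { count = count D ; value = value D ; injective = injective D
      ; attained = λ i → let v , (v∈ , Sv) , eq = attained D i in v , (there v∈ , Sv) , eq
      ; covers = λ { (here refl , _) → known ; (there v∈ , Sv) → covers D (v∈ , Sv) } }
      where open DistinctValues
    ... | no fresh = record
      { count = suc (count D)
      ; value = λ { zero → f y ; (suc i) → value D i }
      ; injective = λ
        { {zero}  {zero}  _  → refl
        ; {zero}  {suc j} eq → contradiction (j , eq) fresh
        ; {suc i} {zero}  eq → contradiction (i , sym eq) fresh
        ; {suc i} {suc j} eq → cong suc (injective D eq) }
      ; attained = λ
        { zero → y , (here refl , Sy) , refl
        ; (suc i) → let v , (v∈ , Sv) , eq = attained D i in v , (there v∈ , Sv) , eq }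
      ; covers = λ
        { (here refl , _) → zero , refl
        ; (there v∈ , Sv) → let i , eq = covers D (v∈ , Sv) in suc i , eq } }
      where open DistinctValues
    open DistinctValues (among vertices)

  record CoTree {L : Set} (Q : L → Set) (h : ℕ) (S : V → Set) (R : V → V → L → Set) : Set where
    field
      tree   : Tree L V
      height : Height≤ h tree
      labels : AllLabels Q tree
      leaves : LeavesExactly tree S
      lca    : ∀ {u v x} → Lca tree u v x → R u v x

  lca⇒∈ : ∀ {L : Set} {T : Tree L V} {u v x} → Lca T u v x → u ∈T T × v ∈T T
  lca⇒∈ (split i j _ p q) = child i p , child j q
  lca⇒∈ (down i l) = let p , q = lca⇒∈ l in child i p , child i q

  Fibre : {K : Set} → (V → K) → (V → Set) → K → V → Set
  Fibre f S y v = S v × f v ≡ y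

  -- Fibres over distinct values are disjoint, so each vertex stays a single leaf. A node may have
  -- just one child, which lets all branches share the same levels.
  joinFibres : ∀ {L K : Set} {Q : L → Set} {h R} → DecidableEquality K → (f : V → K) (x : L) → Q x →
    Decidable S → ∃ S → (∀ y → ∃ (Fibre f S y) → CoTree Q h (Fibre f S y) R) →
    CoTree Q (suc h) S (λ u v z → (f u ≢ f v × z ≡ x) ⊎ (f u ≡ f v × R u v z))
  joinFibres {S} _≟ᵏ_ f x Qx S? (w , Sw) fibre = join (distinctValues _≟ᵏ_ f S?)
    where
    join : DistinctValues f S → CoTree _ _ S _
    -- A node needs at least one child; `S` is nonempty, so some value is attained.
    join D@record { count = zero } with () ← proj₁ (DistinctValues.covers D Sw)
    join D@record { count = suc k } = record
      { tree   = node x k subtree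
      ; height = node (height ∘ sub)
      ; labels = node Qx (labels ∘ sub)
      ; leaves =
          (λ { v (child i p) → proj₁ (∈⇒fibre i p) }) ,
          (λ v Sv → let i , eq = covers Sv in child i (proj₁ (proj₂ (leaves (sub i))) v (Sv , eq))) ,
          unique
      ; lca    = λ
        { (split i j i≢j p q) → inj₁ ((λ eq → i≢j (injective
            (trans (sym (proj₂ (∈⇒fibre i p))) (trans eq (proj₂ (∈⇒fibre j q)))))) , refl)
        ; (down i l) → let p , q = lca⇒∈ l in
            inj₂ (trans (proj₂ (∈⇒fibre i p)) (sym (proj₂ (∈⇒fibre i q))) , lca (sub i) l) } }
      where
      open DistinctValues D
      open CoTree
      sub = λ i → fibre (value i) (attained i)
      subtree = λ i → tree (sub i)
      ∈⇒fibre : ∀ i {v} → v ∈T subtree i → Fibre f S (value i) v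
      ∈⇒fibre i {v} = proj₁ (leaves (sub i)) v
      unique : ∀ v (p q : v ∈T node x k subtree) → p ≡ q
      unique v (child i p) (child j q)
        with injective (trans (sym (proj₂ (∈⇒fibre i p))) (proj₂ (∈⇒fibre j q)))
      ... | refl = cong (child i) (proj₂ (proj₂ (leaves (sub i))) v p q)

  -- x is the label of the lowest common ancestor of u and v, when the nodes of level ℓ are
  -- labelled by ν ℓ and a last level h separates vertices with the same ancestors.
  Meet : {L : Set} → (ℕ → L) → ℕ → (ℕ → V → List V) → V → V → L → Set
  Meet ν zero    κ u v x = x ≡ ν 0
  Meet ν (suc h) κ u v x = (κ 0 u ≢ κ 0 v × x ≡ ν 0) ⊎
                           (κ 0 u ≡ κ 0 v × Meet (ν ∘ suc) h (κ ∘ suc) u v x)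

  coTree : ∀ {L : Set} {Q : L → Set} (ν : ℕ → L) → (∀ ℓ → Q (ν ℓ)) → ∀ h κ → Decidable S → ∃ S →
    CoTree Q (suc h) S (Meet ν h κ)
  coTree {S} {Q = Q} ν Qν zero κ S? nonempty = record
    { CoTree C ; lca = λ l → meet (CoTree.lca C l) }
    where
    leafTree : ∀ y → ∃ (Fibre (λ v → v) S y) → CoTree Q 0 (Fibre (λ v → v) S y) (λ _ _ _ → ⊥)
    leafTree y (w , Sw , refl) = record
      { tree = leaf w ; height = leaf ; labels = leaf
      ; leaves = (λ { v here → Sw , refl }) , (λ { v (_ , refl) → here }) , (λ { v here here → refl })
      ; lca = λ () }
    C = joinFibres _≟_ (λ v → v) (ν 0) (Qν 0) S? nonempty leafTree
    meet : ∀ {A B : Set} {x} → (A × x ≡ ν 0) ⊎ (B × ⊥) → x ≡ ν 0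
    meet (inj₁ (_ , x≡)) = x≡
  coTree ν Qν (suc h) κ S? nonempty = joinFibres (≡-dec _≟_) (κ 0) (ν 0) (Qν 0) S? nonempty
    λ y → coTree (ν ∘ suc) (Qν ∘ suc) h (κ ∘ suc) (λ v → S? v ×-dec ≡-dec _≟_ (κ 0 v) y)

  meet-sym : ∀ {L : Set} {ν : ℕ → L} h {κ u v x} → Meet ν h κ u v x → Meet ν h κ v u x
  meet-sym zero    x≡ = x≡
  meet-sym (suc h) (inj₁ (k≢ , x≡)) = inj₁ (k≢ ∘ sym , x≡)
  meet-sym (suc h) (inj₂ (k≡ , m))  = inj₂ (sym k≡ , meet-sym h m)

  alternate : Bool → ℕ → Bool
  alternate c zero    = c
  alternate c (suc ℓ) = alternate (not c) ℓ

  -- Both relations descend along the same keys to the first level where these differ. `Sep`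
  -- guarantees such a level before the last one, which separates by vertices only.
  meet-sep : ∀ {L : Set} {ν : ℕ → L} (g : Bool → L) h {c κ u v x} → (∀ ℓ → ν ℓ ≡ g (alternate c ℓ)) →
    Meet ν h κ u v x → Sep c h κ u v → x ≡ g (E u v)
  meet-sep g (suc h) ν≡ (inj₁ (_ , x≡))  (inj₁ (_ , e))  = trans x≡ (trans (ν≡ 0) (cong g (sym e)))
  meet-sep g (suc h) ν≡ (inj₁ (k≢ , _))  (inj₂ (k≡ , _)) = contradiction k≡ k≢
  meet-sep g (suc h) ν≡ (inj₂ (k≡ , _))  (inj₁ (k≢ , _)) = contradiction k≡ k≢
  meet-sep g (suc h) ν≡ (inj₂ (_ , m))   (inj₂ (_ , sp)) = meet-sep g h (ν≡ ∘ suc) m sp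

-- Counting labels, and arithmetic.

height-mono : ∀ {L V : Set} {h h′} {T : Tree L V} → h ≤ h′ → Height≤ h T → Height≤ h′ T
height-mono _        leaf     = leaf
height-mono (s≤s le) (node f) = node (λ i → height-mono le (f i))

card : Labels → ℕ
card unit      = 1
card (mux a b) = card a * card b * 2

bit : Bool → Fin 2
bit false = zero
bit true  = suc zero

bit-injective : ∀ {a b} → bit a ≡ bit b → a ≡ b
bit-injective {false} {false} _ = refl
bit-injective {true}  {true}  _ = refl

encode : ∀ L → ⟦ L ⟧ → Fin (card L)
encode unit      _           = zero
encode (mux a b) (x , y , t) = combine (combine (encode a x) (encode b y)) (bit t)

encode-injective : ∀ L {x y} → encode L x ≡ encode L y → x ≡ y
encode-injective unit _ = refl
encode-injective (mux a b) {x , y , t} {x′ , y′ , t′} eq =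
  cong₂ _,_ (encode-injective a (proj₁ eqs))
    (cong₂ _,_ (encode-injective b (proj₂ eqs)) (bit-injective (proj₂ outer)))
  where
  outer = Fin.combine-injective (combine (encode a x) (encode b y)) (bit t)
                                (combine (encode a x′) (encode b y′)) (bit t′) eq
  eqs = Fin.combine-injective (encode a x) (encode b y) (encode a x′) (encode b y′) (proj₁ outer)

double-injective : ∀ {i j} → double i ≡ double j → i ≡ j
double-injective {zero}  {zero}  _  = refl
double-injective {suc i} {suc j} eq = cong suc (double-injective (suc-injective (suc-injective eq)))

double+double : ∀ k → double k + double k ≡ 4 * k
double+double zero    = refl
double+double (suc k) = trans
  (cong (2 +_) (trans (+-suc (double k) (suc (double k))) (cong suc (+-suc (double k) (double k)))))
  (trans (cong (4 +_) (double+double k)) (sym (*-suc 4 k)))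

double<⌊⌋ : ∀ t {i} → i < ⌊ t /2⌋ → suc (double i) < t
double<⌊⌋ (suc (suc t)) {zero}  _        = s≤s (s≤s z≤n)
double<⌊⌋ (suc (suc t)) {suc i} (s≤s lt) = s≤s (s≤s (double<⌊⌋ t lt))

double<⌈⌉ : ∀ t {i} → i < ⌈ t /2⌉ → double i < t
double<⌈⌉ t lt = ≤-pred (double<⌊⌋ (suc t) lt)

near-double : ∀ i j → near (double i) (suc (double j)) ≡ ((i ≡ᵇ j) ∨ (i ≡ᵇ suc j))
near-double zero          zero          = refl
near-double zero          (suc j)       = refl
near-double (suc zero)    zero          = refl
near-double (suc (suc i)) zero          = refl
near-double (suc i)       (suc j)       = near-double i j

all-lca : ∀ {L V : Set} {Q : L → Set} {T : Tree L V} {u v x} → AllLabels Q T → Lca T u v x → Q x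
all-lca (node q _)  (split _ _ _ _ _) = q
all-lca (node _ qs) (down i l)        = all-lca (qs i) l

mapLabels : ∀ {L V : Set} {Q Q′ : L → Set} {T : Tree L V} → (∀ {x} → Q x → Q′ x) →
  AllLabels Q T → AllLabels Q′ T
mapLabels f leaf        = leaf
mapLabels f (node q qs) = node (f q) (mapLabels f ∘ qs)

crossLabel : Bool → BiLabel
crossLabel b a a′ = cross a a′ b

IsCrossLabel : BiLabel → Set
IsCrossLabel f = ∃[ b ] f ≡ crossLabel b

cross-valid : ∀ {f} → IsCrossLabel f → ValidBiLabel f
cross-valid (b , refl) =
  (λ { zero zero → refl ; zero (suc _) → refl ; (suc _) zero → refl ; (suc _) (suc _) → refl }) ,
  refl , refl

-- Excluded induced subgraphs in a bipartite graph.

module _ (G : BGraph) where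

  private
    vertexList : List (Vertex G)
    vertexList = map inj₁ (allFin (m G)) ++ map inj₂ (allFin (n G))

    inVertexList : ∀ v → v ∈ vertexList
    inVertexList (inj₁ a) = ∈-++⁺ˡ (∈-map⁺ inj₁ (∈-allFin a))
    inVertexList (inj₂ b) = ∈-++⁺ʳ (map inj₁ (allFin (m G))) (∈-map⁺ inj₂ (∈-allFin b))

    Adj-sym : ∀ u v → Adj G u v ≡ Adj G v u
    Adj-sym (inj₁ _) (inj₁ _) = refl
    Adj-sym (inj₁ _) (inj₂ _) = refl
    Adj-sym (inj₂ _) (inj₁ _) = refl
    Adj-sym (inj₂ _) (inj₂ _) = refl

    Adj-sameSide : ∀ u v → sideOf G u ≡ sideOf G v → Adj G u v ≡ false
    Adj-sameSide (inj₁ _) (inj₁ _) _ = refl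
    Adj-sameSide (inj₂ _) (inj₂ _) _ = refl

    toFirst : ∀ v → sideOf G v ≡ true → ∃[ a ] v ≡ inj₁ a
    toFirst (inj₁ a) _ = a , refl

    toSecond : ∀ v → sideOf G v ≡ false → ∃[ b ] v ≡ inj₂ b
    toSecond (inj₂ b) _ = b , refl

  open Structure (Vertex G) (Sum.≡-dec Fin._≟_ Fin._≟_) vertexList inVertexList
    (sideOf G) (Adj G) Adj-sym

  -- `s` is the side that receives the first side of `K`; for `false` the sides are exchanged.
  embed : ∀ K s (f : Fin (m K) → Vertex G) (g : Fin (n K) → Vertex G) →
    (∀ i → sideOf G (f i) ≡ s) → (∀ j → sideOf G (g j) ≡ not s) →
    (∀ {i i′} → f i ≡ f i′ → i ≡ i′) → (∀ {j j′} → g j ≡ g j′ → j ≡ j′) →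
    (∀ i j → Adj G (f i) (g j) ≡ adj K i j) → InducedIn K G
  embed K true f g fs gs f-inj g-inj e = inj₁ record
    { f₁ = λ i → proj₁ (F i) ; f₂ = λ j → proj₁ (G′ j)
    ; inj₁' = λ {i} {i′} eq → f-inj (trans (proj₂ (F i)) (trans (cong inj₁ eq) (sym (proj₂ (F i′)))))
    ; inj₂' = λ {j} {j′} eq → g-inj (trans (proj₂ (G′ j)) (trans (cong inj₂ eq) (sym (proj₂ (G′ j′)))))
    ; pres = λ i j → trans (sym (e i j)) (cong₂ (Adj G) (proj₂ (F i)) (proj₂ (G′ j))) }
    where
    F  = λ i → toFirst (f i) (fs i)
    G′ = λ j → toSecond (g j) (gs j)
  embed K false f g fs gs f-inj g-inj e = inj₂ record
    { f₁ = λ i → proj₁ (F i) ; f₂ = λ j → proj₁ (G′ j)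
    ; inj₁' = λ {i} {i′} eq → f-inj (trans (proj₂ (F i)) (trans (cong inj₂ eq) (sym (proj₂ (F i′)))))
    ; inj₂' = λ {j} {j′} eq → g-inj (trans (proj₂ (G′ j)) (trans (cong inj₁ eq) (sym (proj₂ (G′ j′)))))
    ; pres = λ i j → trans (sym (e i j)) (cong₂ (Adj G) (proj₂ (F i)) (proj₂ (G′ j))) }
    where
    F  = λ i → toSecond (f i) (fs i)
    G′ = λ j → toFirst (g j) (gs j)

  -- The spare vertex serves chains ending in `true`: dropping the last one leaves a chain ending in
  -- `false`.
  chain⇒H : ∀ k s e n → suc (double k) ≤ n → Chain s e n (λ _ → ⊥) → InducedIn (H k) G
  chain⇒H k s false n le ch = embed (H k) s lower upper lower-side upper-side
    (lower-injective h) (upper-injective h) lower-upper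
    where
    h = chain⇒halfGraph k (<⇒≤ le) ch
    open HalfGraph h
  chain⇒H k s true (suc n) (s≤s le) (_ , _ , _ , ch) =
    embed (H k) s lower upper lower-side upper-side
      (lower-injective h) (upper-injective h) lower-upper
    where
    h = chain⇒halfGraph k le ch
    open HalfGraph h

  private
    parity-double : ∀ i → parity (double i) ≡ false
    parity-double zero    = refl
    parity-double (suc i) = trans (not-involutive _) (parity-double i)

    pathIn : Bool → ℕ → BGraph
    pathIn true  t = P t
    pathIn false t = bcomp (P t)

  -- The path has `t + 1` vertices, one more than `P t`, because telling two positions apart uses a
  -- neighbour further back. Colour `false` yields the complement.
  path⇒P : ∀ t c v C → Path c t v C → InducedIn (pathIn c t) G
  path⇒P t c v C path = embedPath c even-odd
    where
    M = path⇒map t path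
    open PathMap M
    even : Fin ⌈ t /2⌉ → Vertex G
    even i = at (double (toℕ i))
    odd : Fin ⌊ t /2⌋ → Vertex G
    odd j = at (suc (double (toℕ j)))
    even< : (i : Fin ⌈ t /2⌉) → double (toℕ i) < t
    even< i = double<⌈⌉ t (Fin.toℕ<n i)
    odd< : (j : Fin ⌊ t /2⌋) → suc (double (toℕ j)) < t
    odd< j = double<⌊⌋ t (Fin.toℕ<n j)
    even-side : ∀ i → sideOf G (even i) ≡ sideOf G v
    even-side i = trans (at-side (<⇒≤ (even< i)))
      (cong (_xor sideOf G v) (parity-double (toℕ i)))
    odd-side : ∀ j → sideOf G (odd j) ≡ not (sideOf G v)
    odd-side j = trans (at-side (<⇒≤ (odd< j)))
      (cong (λ p → not p xor sideOf G v) (parity-double (toℕ j)))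
    even-injective : ∀ {i i′} → even i ≡ even i′ → i ≡ i′
    even-injective {i} {i′} eq = Fin.toℕ-injective (double-injective
      (at-injective M (even< i) (even< i′)
        (trans (parity-double (toℕ i)) (sym (parity-double (toℕ i′)))) eq))
    odd-injective : ∀ {j j′} → odd j ≡ odd j′ → j ≡ j′
    odd-injective {j} {j′} eq = Fin.toℕ-injective (double-injective (suc-injective
      (at-injective M (odd< j) (odd< j′)
        (cong not (trans (parity-double (toℕ j)) (sym (parity-double (toℕ j′))))) eq)))
    even-odd : ∀ i j → Adj G (even i) (odd j) ≡ (if adj (P t) i j then c else not c)
    even-odd i j = trans
      (at-near (<⇒≤ (even< i)) (<⇒≤ (odd< j)) λ p → contradiction
        (trans (sym (parity-double (toℕ i))) (trans p (cong not (parity-double (toℕ j))))) λ ())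
      (cong (if_then c else not c) (near-double (toℕ i) (toℕ j)))
    embedPath : ∀ c → (∀ i j → Adj G (even i) (odd j) ≡ (if adj (P t) i j then c else not c)) →
      InducedIn (pathIn c t) G
    embedPath true eo = embed (P t) _ even odd even-side odd-side even-injective odd-injective
      λ i j → trans (eo i j) (if-true (adj (P t) i j))
      where
      if-true : ∀ b → (if b then true else false) ≡ b
      if-true true  = refl
      if-true false = refl
    embedPath false eo = embed (bcomp (P t)) _ even odd even-side odd-side even-injective odd-injective
      λ i j → trans (eo i j) (if-false (adj (P t) i j))
      where
      if-false : ∀ b → (if b then false else true) ≡ not b
      if-false true  = refl
      if-false false = refl

  -- From a split to a cosplit.

  split⇒cosplit : ∀ {h h′} L → suc h ≤ h′ → Split true h ⟦ L ⟧ (λ _ → ⊤) → Cosplit G (card L * 2) h′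
  split⇒cosplit {h} {h′} L h<h′ sp =
    count , Fin.injective⇒≤ injective , part , part-onto , (λ i → σ i , λ v → part-side) ,
    cograph , biCograph
    where
    open Split sp
    -- A part is an attained pair of label and side, whence the factor 2.
    code : Vertex G → Fin (card L * 2)
    code v = combine (encode L (lab v)) (bit (sideOf G v))
    D = distinctValues {S = λ _ → ⊤} Fin._≟_ code (λ _ → yes tt)
    open DistinctValues D
    part : Vertex G → Fin count
    part v = proj₁ (covers {v} tt)
    rep : Fin count → Vertex G
    rep i = proj₁ (attained i)
    σ : Fin count → Bool
    σ i = sideOf G (rep i)
    part-onto : ∀ i → ∃[ v ] part v ≡ i
    part-onto i = rep i ,
      injective (trans (sym (proj₂ (covers {rep i} tt))) (proj₂ (proj₂ (attained i))))
    part-code : ∀ {i v} → part v ≡ i → lab v ≡ lab (rep i) × sideOf G v ≡ σ i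
    part-code {i} {v} refl = encode-injective L (proj₁ eqs) , bit-injective (proj₂ eqs)
      where
      eqs = Fin.combine-injective (encode L (lab v)) (bit (sideOf G v))
        (encode L (lab (rep i))) (bit (σ i))
        (trans (proj₂ (covers {v} tt)) (sym (proj₂ (proj₂ (attained i)))))
    part-side : ∀ {i v} → part v ≡ i → sideOf G v ≡ σ i
    part-side = proj₂ ∘ part-code

    flat : ∀ {X : Set} {Q : X → Set} {S : Vertex G → Set} (x : X) → Q x → Decidable S → ∃ S →
      CoTree Q 1 S (λ _ _ y → y ≡ x)
    flat x q = coTree (λ _ → x) (λ _ → q) 0 (λ _ _ → [])

    -- A part lies on one side, so one node labelled `false` suffices.
    cograph : ∀ i → IsCograph h′ (λ v → part v ≡ i) (Adj G)
    cograph i = tree , height-mono (≤-trans (s≤s z≤n) h<h′) height , leaves ,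
      λ u v x _ u∈ v∈ l → trans
        (Adj-sameSide u v (trans (part-side (proj₁ leaves u u∈)) (sym (part-side (proj₁ leaves v v∈)))))
        (sym (lca l))
      where open CoTree (flat {Q = λ _ → ⊤} false tt (λ v → part v Fin.≟ i) (part-onto i))

    module _ (i j : Fin count) (i≢j : i ≢ j) where

      Pair : Vertex G → Set
      Pair v = part v ≡ i ⊎ part v ≡ j

      pair? : Decidable Pair
      pair? v = part v Fin.≟ i ⊎-dec part v Fin.≟ j

      nonempty : ∃ Pair
      nonempty = let v , eq = part-onto i in v , inj₁ eq

      fromCoTree : ∀ {g R} → g ≤ h′ → CoTree IsCrossLabel g Pair R →
        (∀ {u v x} → Pair u → Pair v → part u ≢ part v → R u v x → x ≡ crossLabel (Adj G u v)) →
        IsBiCograph h′ (λ v → part v ≡ i) (λ v → part v ≡ j) (Adj G)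
      fromCoTree {R = R} g≤ C correct =
        tree , height-mono g≤ height , mapLabels cross-valid labels , leaves ,
        λ u v x cu cv _ u∈ v∈ l Cu Cv →
          predict cu cv (proj₁ leaves u u∈) (proj₁ leaves v v∈) (all-lca labels l) (lca l) Cu Cv
        where
        open CoTree C
        colour = Col (λ v → part v ≡ i) (λ v → part v ≡ j)
        predict : ∀ {u v x} cu cv → Pair u → Pair v → IsCrossLabel x → R u v x →
          colour u cu → colour v cv → cross cu cv (Adj G u v) ≡ x cu cv
        predict zero    zero    _ _ (_ , refl) _ _ _ = refl
        predict (suc _) (suc _) _ _ (_ , refl) _ _ _ = refl
        predict zero    (suc y) Pu Pv _ r ui vj =
          cong (λ f → f zero (suc y))
            (sym (correct Pu Pv (λ eq → i≢j (trans (sym ui) (trans eq vj))) r))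
        predict (suc y) zero    Pu Pv _ r uj vi =
          cong (λ f → f (suc y) zero)
            (sym (correct Pu Pv (λ eq → i≢j (trans (sym vi) (trans (sym eq) uj))) r))

      sameSide : σ i ≡ σ j → IsBiCograph h′ (λ v → part v ≡ i) (λ v → part v ≡ j) (Adj G)
      sameSide σ≡ = fromCoTree (≤-trans (s≤s z≤n) h<h′)
        (flat (crossLabel false) (false , refl) pair? nonempty)
        λ {u} {v} Pu Pv _ x≡ → trans x≡
          (cong crossLabel (sym (Adj-sameSide u v (trans (side-i Pu) (sym (side-i Pv))))))
        where
        side-i : ∀ {v} → Pair v → sideOf G v ≡ σ i
        side-i (inj₁ eq) = part-side eq
        side-i (inj₂ eq) = trans (part-side eq) (sym σ≡)

      -- `p` and `q` are `i` and `j` in the order that `key` expects, the part on the `true` side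
      -- first.
      oppositeSides : ∀ p q → σ p ≡ true → σ q ≡ false → (∀ {v} → Pair v → part v ≡ p ⊎ part v ≡ q) →
        IsBiCograph h′ (λ v → part v ≡ i) (λ v → part v ≡ j) (Adj G)
      oppositeSides p q σp σq pq = fromCoTree h<h′
        (coTree (crossLabel ∘ alternate true) (λ _ → _ , refl) h κ pair? nonempty)
        λ Pu Pv ≢part → correct (pq Pu) (pq Pv) ≢part
        where
        κ = key (lab (rep p)) (lab (rep q))
        sepκ : ∀ {u v} → part u ≡ p → part v ≡ q → Sep true h κ u v
        sepκ {u} {v} up vq = subst₂ (λ a b → Sep true h (key a b) u v)
          (proj₁ (part-code up)) (proj₁ (part-code vq))
          (sep tt tt (trans (part-side up) σp) (trans (part-side vq) σq))
        correct : ∀ {u v x} → part u ≡ p ⊎ part u ≡ q → part v ≡ p ⊎ part v ≡ q → part u ≢ part v →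
          Meet (crossLabel ∘ alternate true) h κ u v x → x ≡ crossLabel (Adj G u v)
        correct (inj₁ up) (inj₁ vp) ≢part _ = contradiction (trans up (sym vp)) ≢part
        correct (inj₂ uq) (inj₂ vq) ≢part _ = contradiction (trans uq (sym vq)) ≢part
        correct (inj₁ up) (inj₂ vq) _ mt = meet-sep crossLabel h (λ _ → refl) mt (sepκ up vq)
        correct {u} {v} (inj₂ uq) (inj₁ vp) _ mt = trans
          (meet-sep crossLabel h (λ _ → refl) (meet-sym h mt) (sepκ vp uq))
          (cong crossLabel (Adj-sym v u))

    biCograph : ∀ i j → i ≢ j → IsBiCograph h′ (λ v → part v ≡ i) (λ v → part v ≡ j) (Adj G)
    biCograph i j i≢j with σ i in σi | σ j in σj
    ... | true  | true  = sameSide i j i≢j (trans σi (sym σj))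
    ... | false | false = sameSide i j i≢j (trans σi (sym σj))
    ... | true  | false = oppositeSides i j i≢j i j σi σj λ p → p
    ... | false | true  = oppositeSides i j i≢j j i σj σi Sum.swap

  excludes⇒cosplit : ∀ t k → Excludes G (P t) → Excludes G (bcomp (P t)) → Excludes G (H (suc k)) →
    Cosplit G (card (splitLabels t (4 * suc k ∸ 3)) * 2) (4 * suc k)
  excludes⇒cosplit t k noP noP̃ noH = split⇒cosplit (splitLabels t K) (≤-reflexive 3+K≡)
    (decompose K true (λ _ → yes tt) record
      { s₀ = true ; s₁ = false ; e₁ = true ; n₀ = 0 ; n₁ = 0
      ; differ = λ () ; chain₀ = tt ; chain₁ = tt ; long = ≤-refl })
    where
    -- The height `4 * suc k` leaves `K` levels for steps: two go to homogeneous sets and one to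
    -- separating the vertices at the leaves.
    K = 4 * suc k ∸ 3
    3+K≡ : 3 + K ≡ 4 * suc k
    3+K≡ = m+[n∸m]≡n (≤-trans (s≤s (s≤s (s≤s z≤n))) (≤-reflexive (sym (*-suc 4 k))))
    noPath : ∀ c v C → ¬ Path c t v C
    noPath true  v C path = noP (path⇒P t true v C path)
    noPath false v C path = noP̃ (path⇒P t false v C path)
    open Decompose t (double (suc k)) K
      (≤-reflexive (trans (double+double (suc k)) (sym 3+K≡)))
      noPath (λ s e n le ch → noH (chain⇒H (suc k) s e n le ch))

theorem5p1 : (t k : ℕ) → ∃[ N ] ((G : BGraph) →
    Excludes G (P t) → Excludes G (bcomp (P t)) → Excludes G (H k) →
    Cosplit G N (4 * k))
-- `H 0` has no vertices and embeds in every graph.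
theorem5p1 t zero = 0 , λ G _ _ noH → ⊥-elim (noH (inj₁ record
  { f₁ = λ () ; f₂ = λ () ; inj₁' = λ {} ; inj₂' = λ {} ; pres = λ () }))
theorem5p1 t (suc k) = _ , λ G → excludes⇒cosplit G t k
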